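{- When the simple graph $G$ is $2$-edge-connected, the critical group $K(\operatorname{line} G)$ can be generated by $\beta(G)$ elements.
   Context: For a graph $G=(V,E)$, $K(G)$ denotes its critical group, the finite abelian group ${\mathbb Z}^E/(B\oplus Z)$ where $B$ and $Z$ are the bond and cycle lattices of $G$; its order is the number of spanning forests. $\beta(G)$ is the number of independent cycles of $G$. $\operatorname{line} G$ denotes the line graph of $G$: its vertex set is $E$, with an edge for each pair of edges of $G$ incident at a vertex. A graph is $2$-edge-connected if it is connected and has no cut-edge. -}

module Defs where

open import Data.Nat using (ℕ; zero; suc; _∸_) renaming (_+_ to _+ℕ_)
open import Data.Fin using (Fin; zero; suc; toℕ; _≟_)
open import Data.Bool using (Bool; true; false; if_then_else_; _∨_; _∧_)
open import Data.Integer using (ℤ; _+_; _-_; _*_) renaming (0ℤ to 0ℤ; 1ℤ to 1ℤ)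
open import Data.List using (List; []; _∷_; length; lookup; concatMap; filterᵇ; allFin)
open import Data.Product using (_×_; _,_; proj₁; proj₂; Σ; ∃)
open import Data.Sum using (_⊎_)
open import Data.Empty using (⊥)
open import Relation.Nullary using (¬_)
open import Relation.Nullary.Decidable using (⌊_⌋)
open import Relation.Binary.PropositionalEquality using (_≡_)
import Data.Nat as ℕ

-- Finite graphs: vertex set Fin nV, a list of edges, each edge given
-- with an (arbitrary, fixed) orientation  src e → tgt e.

record Graph : Set where
  field
    nV    : ℕ
    edges : List (Fin nV × Fin nV)

open Graph public

nE : Graph → ℕ
nE G = length (edges G)

Edge : Graph → Set
Edge G = Fin (nE G)

Vertex : Graph → Set
Vertex G = Fin (nV G)

src tgt : (G : Graph) → Edge G → Vertex G
src G e = proj₁ (lookup (edges G) e)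
tgt G e = proj₂ (lookup (edges G) e)

IsSimple : Graph → Set
IsSimple G =
  ((e : Edge G) → ¬ (src G e ≡ tgt G e)) ×
  ((e f : Edge G) → ¬ (e ≡ f) →
     ¬ ((src G e ≡ src G f × tgt G e ≡ tgt G f) ⊎
        (src G e ≡ tgt G f × tgt G e ≡ src G f)))

data Walk (G : Graph) (avoid : Edge G → Set) : Vertex G → Vertex G → Set where
  stay : ∀ {u} → Walk G avoid u u
  fwd  : ∀ {v} (e : Edge G) → ¬ avoid e → Walk G avoid (tgt G e) v → Walk G avoid (src G e) v
  bwd  : ∀ {v} (e : Edge G) → ¬ avoid e → Walk G avoid (src G e) v → Walk G avoid (tgt G e) v

noEdge : (G : Graph) → Edge G → Set
noEdge _ _ = ⊥

Connected : Graph → Set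
Connected G = (u v : Vertex G) → Walk G (noEdge G) u v

IsCutEdge : (G : Graph) → Edge G → Set
IsCutEdge G e = ¬ Walk G (λ f → f ≡ e) (src G e) (tgt G e)

TwoEdgeConnected : Graph → Set
TwoEdgeConnected G = Connected G × ((e : Edge G) → ¬ IsCutEdge G e)

-- Number of connected components of a *connected* graph (1, or 0 for the
-- empty graph), and β(G) = |E| - |V| + c(G) for connected G.

componentsOfConnected : Graph → ℕ
componentsOfConnected G with nV G
... | zero  = 0
... | suc _ = 1

beta : Graph → ℕ
beta G = (nE G +ℕ componentsOfConnected G) ∸ nV G

shareEnd : (G : Graph) → Edge G → Edge G → Bool
shareEnd G i j =
  ⌊ src G i ≟ src G j ⌋ ∨ ⌊ src G i ≟ tgt G j ⌋ ∨
  ⌊ tgt G i ≟ src G j ⌋ ∨ ⌊ tgt G i ≟ tgt G j ⌋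

lineEdges : (G : Graph) → List (Edge G × Edge G)
lineEdges G =
  concatMap (λ i →
    concatMap (λ j → if (toℕ i ℕ.<ᵇ toℕ j) ∧ shareEnd G i j then (i , j) ∷ [] else [])
      (allFin (nE G)))
    (allFin (nE G))

line : Graph → Graph
line G = record { nV = nE G ; edges = lineEdges G }

sumℤ : ∀ {n} → (Fin n → ℤ) → ℤ
sumℤ {zero}  f = 0ℤ
sumℤ {suc n} f = f zero + sumℤ (λ i → f (suc i))

ind : ∀ {n} → Fin n → Fin n → ℤ
ind a b = if ⌊ a ≟ b ⌋ then 1ℤ else 0ℤ

Chain : Graph → Set
Chain G = Edge G → ℤ

∂ : (G : Graph) → Chain G → Vertex G → ℤ
∂ G c v = sumℤ (λ e → c e * (ind (tgt G e) v - ind (src G e) v))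

δ : (G : Graph) → (Vertex G → ℤ) → Chain G
δ G p e = p (tgt G e) - p (src G e)

InCycleLattice : (G : Graph) → Chain G → Set
InCycleLattice G z = (v : Vertex G) → ∂ G z v ≡ 0ℤ

InBondLattice : (G : Graph) → Chain G → Set
InBondLattice G b = Σ (Vertex G → ℤ) (λ p → (e : Edge G) → b e ≡ δ G p e)

-- K(G) = ℤ^E / (B ⊕ Z) can be generated by k elements: there are
-- g₁..g_k ∈ ℤ^E whose classes generate the quotient, i.e. every x ∈ ℤ^E is
-- an integer combination of the gᵢ plus an element of B plus an element of Z.
CriticalGroupGeneratedBy : Graph → ℕ → Set
CriticalGroupGeneratedBy G k =
  Σ (Fin k → Chain G) λ g →
    (x : Chain G) →
      Σ (Fin k → ℤ) λ a →
      Σ (Chain G) λ b →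
      Σ (Chain G) λ z →
        InBondLattice G b × InCycleLattice G z ×
        ((e : Edge G) → x e ≡ (sumℤ (λ i → a i * g i e) + b e) + z e)

{-# OPTIONS --safe #-}
module Submission where

-- Fix an edge e₀. As line G is connected, each edge e of G has a chain γ e of line G with boundary e − e₀; the
-- classes of the γ e generate K(line G), and the bond at e = uv gives the relation
--   (deg u + deg v) γ e = σ u + σ v,   where σ u is the sum of γ f over the edges f at u (the star of u).
-- So γ e and σ u determine σ v, and σ u together with γ on all edges at u but one determines γ on the last one.
-- Grow a spanning tree from a root r, a new vertex v being attached by an edge f whose removal, on top of the tree,
-- leaves v and all remaining vertices connected to r; this is possible because G has no cut edge. From σ r and γ on
-- the edges outside the tree one then recovers γ on the tree edges, the last attached first: σ v is obtained
-- along a path that avoids the tree, and then γ f, because f is the only tree edge at v that is not yet known.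
-- The β(G) edges outside the tree include e₀, and γ e₀ = 0, so that σ r brings the number of generators to β(G).

open import Defs

open import Data.Bool using (Bool; true; false; if_then_else_; _∧_)
open import Data.Bool.Properties using (T-≡; ¬-not)
open import Data.Fin using (Fin; zero; suc; toℕ; _≟_)
open import Data.Fin.Properties using (any?; suc-injective; toℕ-injective)
open import Data.Fin.Subset
  using (Subset; inside; outside; _∈_; _∉_; _⊆_; _⊃_; _∪_; ⁅_⁆; ∣_∣; ∁; ⊥)
open import Data.Fin.Subset.Induction using (⊃-wellFounded; Acc; acc)
open import Data.Fin.Subset.Properties
  using (_∈?_; x∈p∪q⁺; x∈p∪q⁻; x∈⁅x⁆; x∈⁅y⁆⇒x≡y; x∉p⇒x∈∁p; ∪-identityʳ; ∉⊥; ∈⊤; ⊆-antisym;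
         ∣⊥∣≡0; ∣⁅x⁆∣≡1; ∣⊤∣≡n; ∣∁p∣≡n∸∣p∣)
open import Data.Integer using (ℤ; _+_; _-_; _*_; -_; 0ℤ; 1ℤ; -1ℤ)
open import Data.Integer.Properties
  using (+-identityˡ; +-identityʳ; +-inverseʳ; +-assoc; neg-distrib-+; -1*i≡-i;
         *-zeroˡ; *-zeroʳ; *-identityˡ; *-identityʳ; *-assoc; *-comm; *-distribˡ-+)
open import Data.Integer.Tactic.RingSolver using (solve-∀)
open import Data.List using (List; []; _∷_; _++_; lookup; concatMap; tabulate; allFin)
open import Data.List.Membership.Propositional using (lose) renaming (_∈_ to _∈ᴸ_)
open import Data.List.Membership.Propositional.Properties using (∈-concatMap⁺; ∈-allFin)
open import Data.List.Relation.Unary.Any as Any using (index)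
open import Data.List.Relation.Unary.Any.Properties using (lookup-index)
open import Data.Nat using (zero; suc; _<_; _<ᵇ_; _∸_)
import Data.Nat.Properties as ℕ
open import Data.Product using (_×_; _,_; proj₁; proj₂; Σ; ∃-syntax; Σ-syntax)
open import Data.Sum using (_⊎_; inj₁; inj₂; [_,_]′; map₂)
open import Data.Unit using (tt)
open import Data.Vec using (here; there) renaming ([] to []ⱽ; _∷_ to _∷ⱽ_)
open import Function using (_∘_; id; Equivalence)
open import Level using (0ℓ)
open import Relation.Binary.Definitions using (tri<; tri≈; tri>)
open import Relation.Binary.PropositionalEquality
  using (_≡_; _≢_; refl; sym; trans; cong; cong₂; subst; module ≡-Reasoning)
open import Relation.Nullary using (yes; no; ¬_; contradiction)
open import Relation.Nullary.Decidable using (¬?; _×-dec_; decidable-stable)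
open import Relation.Unary using (Pred; Decidable)

-- Inserting one element into a finite subset

∣p∪⁅x⁆∣ : ∀ {n} {p : Subset n} {x} → x ∉ p → ∣ p ∪ ⁅ x ⁆ ∣ ≡ suc ∣ p ∣
∣p∪⁅x⁆∣ {p = inside  ∷ⱽ p} {zero}  x∉p = contradiction here x∉p
∣p∪⁅x⁆∣ {p = outside ∷ⱽ p} {zero}  x∉p = cong (suc ∘ ∣_∣) (∪-identityʳ p)
∣p∪⁅x⁆∣ {p = inside  ∷ⱽ p} {suc x} x∉p = cong suc (∣p∪⁅x⁆∣ (x∉p ∘ there))
∣p∪⁅x⁆∣ {p = outside ∷ⱽ p} {suc x} x∉p = ∣p∪⁅x⁆∣ (x∉p ∘ there)

p∪⁅x⁆⊃p : ∀ {n} {p : Subset n} {x} → x ∉ p → (p ∪ ⁅ x ⁆) ⊃ p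
p∪⁅x⁆⊃p {x = x} x∉p = (x∈p∪q⁺ ∘ inj₁) , x , x∈p∪q⁺ (inj₂ (x∈⁅x⁆ x)) , x∉p

∈-insert⁻ : ∀ {n} {p : Subset n} {x y} → y ∈ p ∪ ⁅ x ⁆ → y ∈ p ⊎ y ≡ x
∈-insert⁻ {p = p} {x} y∈ = map₂ (x∈⁅y⁆⇒x≡y _) (x∈p∪q⁻ p ⁅ x ⁆ y∈)

∉-insert : ∀ {n} {p : Subset n} {x y} → y ∉ p → y ≢ x → y ∉ p ∪ ⁅ x ⁆
∉-insert y∉p y≢x = [ y∉p , y≢x ]′ ∘ ∈-insert⁻

-- Walks, edge cuts and components with forbidden edges

module Forcing (G : Graph) where

  data Joins (e : Edge G) : Vertex G → Vertex G → Set where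
    along   : Joins e (src G e) (tgt G e)
    against : Joins e (tgt G e) (src G e)

  Incident : Edge G → Vertex G → Set
  Incident e v = v ≡ src G e ⊎ v ≡ tgt G e

  Joins-sym : ∀ {e u v} → Joins e u v → Joins e v u
  Joins-sym along   = against
  Joins-sym against = along

  Joins⇒Incidentʳ : ∀ {e u v} → Joins e u v → Incident e v
  Joins⇒Incidentʳ along   = inj₂ refl
  Joins⇒Incidentʳ against = inj₁ refl

  endpoint : ∀ {e u v x y} → Joins e u v → Joins e x y → x ≡ u ⊎ x ≡ v
  endpoint along   along   = inj₁ refl
  endpoint along   against = inj₂ refl
  endpoint against along   = inj₂ refl
  endpoint against against = inj₁ refl

  edge-step : ∀ {avoid e u v w} → Joins e u v → ¬ avoid e → Walk G avoid v w → Walk G avoid u w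
  edge-step along   = fwd _
  edge-step against = bwd _

  record Crossing (Q : Pred (Vertex G) 0ℓ) (e : Edge G) : Set where
    constructor crossing
    field
      {near far} : Vertex G
      joins      : Joins e near far
      near∈      : Q near
      far∉       : ¬ Q far

  crossing? : ∀ {Q} → Decidable Q → Decidable (Crossing Q)
  crossing? Q? e with Q? (src G e) | Q? (tgt G e)
  ... | yes q | no ¬q = yes (crossing along q ¬q)
  ... | no ¬q | yes q = yes (crossing against q ¬q)
  ... | yes p | yes q = no λ { (crossing along _ ¬q) → ¬q q ; (crossing against _ ¬p) → ¬p p }
  ... | no ¬p | no ¬q = no λ { (crossing along p _) → ¬p p ; (crossing against q _) → ¬q q }

  -- The walk is cut at its first exit from `Q`. The walks returned are its tails with and without
  -- the exit edge, so both still respect `avoid`.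
  walk-crosses : ∀ {avoid Q u w} → Decidable Q → Walk G avoid u w → Q u → ¬ Q w →
    ∃[ e ] ¬ avoid e × Σ (Crossing Q e) λ c → Walk G avoid (Crossing.near c) w × Walk G avoid (Crossing.far c) w
  walk-crosses Q? stay q ¬q = contradiction q ¬q
  walk-crosses Q? (fwd e ok p) q ¬q with Q? (tgt G e)
  ... | yes q′ = walk-crosses Q? p q′ ¬q
  ... | no ¬q′ = e , ok , crossing along q ¬q′ , fwd e ok p , p
  walk-crosses Q? (bwd e ok p) q ¬q with Q? (src G e)
  ... | yes q′ = walk-crosses Q? p q′ ¬q
  ... | no ¬q′ = e , ok , crossing against q ¬q′ , bwd e ok p , p

  Closed : Pred (Edge G) 0ℓ → Subset (nV G) → Set
  Closed avoid S = ∀ {e u v} → Joins e u v → ¬ avoid e → u ∈ S → v ∈ S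

  module _ {avoid} {S : Subset (nV G)} (closed : Closed avoid S) where

    walk-closed : ∀ {u v} → Walk G avoid u v → u ∈ S → v ∈ S
    walk-closed stay         = id
    walk-closed (fwd e ok p) = walk-closed p ∘ closed along ok
    walk-closed (bwd e ok p) = walk-closed p ∘ closed against ok

    walk-closed⁻ : ∀ {u v} → Walk G avoid u v → v ∈ S → u ∈ S
    walk-closed⁻ stay         = id
    walk-closed⁻ (fwd e ok p) = closed against ok ∘ walk-closed⁻ p
    walk-closed⁻ (bwd e ok p) = closed along ok ∘ walk-closed⁻ p

  record Component (avoid : Pred (Edge G) 0ℓ) (t : Vertex G) : Set where
    field
      set    : Subset (nV G)
      base   : t ∈ set
      walk   : ∀ {v} → v ∈ set → Walk G avoid v t
      closed : Closed avoid set

  abstract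
    component : ∀ {avoid} → Decidable avoid → ∀ t → Component avoid t
    component {avoid} avoid? t =
      go ⁅ t ⁆ (x∈⁅x⁆ t) (λ v∈ → subst (λ v → Walk G avoid v t) (sym (x∈⁅y⁆⇒x≡y _ v∈)) stay) (⊃-wellFounded _)
      where
      go : ∀ S → t ∈ S → (∀ {v} → v ∈ S → Walk G avoid v t) → Acc _⊃_ S → Component avoid t
      go S t∈S walks (acc rec) with any? (λ e → ¬? (avoid? e) ×-dec crossing? (_∈? S) e)
      ... | no none = record
        { set = S ; base = t∈S ; walk = walks
        ; closed = λ {e} {u} {v} j ok u∈S → decidable-stable (v ∈? S) λ v∉S → none (e , ok , crossing j u∈S v∉S) }
      ... | yes (e , ok , crossing {u} {v} j u∈S v∉S) =
        go (S ∪ ⁅ v ⁆) (x∈p∪q⁺ (inj₁ t∈S))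
          (λ x∈ → [ walks , (λ { refl → edge-step (Joins-sym j) ok (walks u∈S) }) ]′ (∈-insert⁻ x∈))
          (rec (p∪⁅x⁆⊃p v∉S))

  -- Safe edges at the boundary of a partial tree

  module _ (two-edge-connected : TwoEdgeConnected G) where

    -- If `e` alone crossed `Q`, every walk between its ends would use `e`, making it a cut edge.
    -- That hypothesis is a negation, so the other edge itself comes from a search through the
    -- finitely many edges.
    second-crossing : ∀ {Q e} → Decidable Q → Crossing Q e → ∃[ f ] f ≢ e × Crossing Q f
    second-crossing {Q} {e} Q? c with any? (λ f → ¬? (f ≟ e) ×-dec crossing? Q? f)
    ... | yes found = found
    ... | no none = contradiction (cut c) (proj₂ two-edge-connected e)
      where
      cut : Crossing Q e → IsCutEdge G e
      cut (crossing along q ¬q) p with walk-crosses Q? p q ¬q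
      ... | f , f≢e , c , _ = none (f , f≢e , c)
      cut (crossing against q ¬q) p with walk-crosses (¬? ∘ Q?) p ¬q (λ ¬p → ¬p q)
      ... | f , f≢e , crossing j ¬p ¬¬p , _ =
        none (f , f≢e , crossing (Joins-sym j) (decidable-stable (Q? _) ¬¬p) ¬p)

    module _ (r : Vertex G) where

      module _ {C : Subset (nV G)} {W : Subset (nE G)}
        (W-inside : ∀ {e u v} → e ∈ W → Joins e u v → u ∈ C)
        (reachable : ∀ {u} → u ∉ C → Walk G (_∈ W) u r) where

        Safe : Edge G → Set
        Safe f = ∀ {u} → u ∉ C → Walk G (_∈ W ∪ ⁅ f ⁆) u r

        Improvement : ∀ {f} → Component (_∈ W ∪ ⁅ f ⁆) r → Set
        Improvement K = ∃[ g ] g ∉ W × Crossing (_∈ C) g ×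
          Σ (Component (_∈ W ∪ ⁅ g ⁆) r) λ L → Component.set L ⊃ Component.set K

        abstract
          -- If f disconnects u from r, then the component X of u meets C because f is not a cut edge of G,
          -- so X contains a further boundary edge, whose removal keeps strictly more vertices connected to r.
          improve : ∀ {f u} → f ∉ W → u ∉ C →
            (K : Component (_∈ W ∪ ⁅ f ⁆) r) → u ∉ Component.set K → Improvement K
          improve {f} {u} f∉W u∉C K u∉K = around (component (_∈? (W ∪ ⁅ f ⁆)) u)
            where
            module K = Component K

            grows : ∀ {g} (d : Crossing (_∈ C) g) →
              Walk G (_∈ W ∪ ⁅ f ⁆) (Crossing.near d) u → Walk G (_∈ W ∪ ⁅ f ⁆) (Crossing.far d) u →
              g ∉ W ∪ ⁅ f ⁆ → (L : Component (_∈ W ∪ ⁅ g ⁆) r) → Component.set L ⊃ K.set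
            grows {g} d ps qs g∉ L = K⊆L , new
              where
              module L = Component L

              g-outside-K : ∀ {x y} → Joins g x y → x ∉ K.set
              g-outside-K i with endpoint (Crossing.joins d) i
              ... | inj₁ refl = u∉K ∘ walk-closed K.closed ps
              ... | inj₂ refl = u∉K ∘ walk-closed K.closed qs

              -- Both ends of `g` are joined to `u`, so a walk inside `K` never uses `g` and
              -- survives when `g` is forbidden instead of `f`.
              K⊆L : K.set ⊆ L.set
              K⊆L {x} x∈K with x ∈? L.set
              ... | yes x∈L = x∈L
              ... | no x∉L with walk-crosses (¬? ∘ (_∈? L.set)) (K.walk x∈K) x∉L (λ r∉L → r∉L L.base)
              ...   | h , h∉ , crossing j p∉L q∈L , walk , _ with h ≟ g
              ...     | yes refl = contradiction (walk-closed⁻ K.closed walk K.base) (g-outside-K j)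
              ...     | no h≢g = contradiction
                (L.closed (Joins-sym j) (∉-insert (h∉ ∘ x∈p∪q⁺ ∘ inj₁) h≢g) (decidable-stable (_ ∈? L.set) q∈L)) p∉L

              f≢g : f ≢ g
              f≢g refl = g∉ (x∈p∪q⁺ (inj₂ (x∈⁅x⁆ f)))

              -- The walk from `u` to `r` avoids `W`, so it can enter `K` only through `f`. As `f`
              -- is permitted again for `L`, its outer end is gained.
              new : ∃[ x ] x ∈ L.set × x ∉ K.set
              new with walk-crosses (¬? ∘ (_∈? K.set)) (reachable u∉C) u∉K (λ r∉K → r∉K K.base)
              ... | e , e∉W , crossing {p} j p∉K q∈K , _ with e ≟ f
              ...   | yes refl = p , L.closed (Joins-sym j) (∉-insert e∉W f≢g) (K⊆L (decidable-stable (_ ∈? K.set) q∈K)) , p∉K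
              ...   | no e≢f = contradiction
                (K.closed (Joins-sym j) (∉-insert e∉W e≢f) (decidable-stable (_ ∈? K.set) q∈K)) p∉K

            around : Component (_∈ W ∪ ⁅ f ⁆) u → Improvement K
            around X = beyond (f-crosses-X (walk-crosses (_∈? X.set) (reachable u∉C) X.base r∉X))
              where
              module X = Component X

              r∉X : r ∉ X.set
              r∉X r∈X = u∉K (walk-closed K.closed (X.walk r∈X) K.base)

              crosses-X : ∀ {e} → e ∉ W → Crossing (_∈ X.set) e → e ≡ f
              crosses-X {e} e∉W (crossing j p∈X q∉X) =
                decidable-stable (e ≟ f) λ e≢f → q∉X (X.closed j (∉-insert e∉W e≢f) p∈X)

              f-crosses-X : ∀ {P : ∀ {e} → Crossing (_∈ X.set) e → Set} →
                ∃[ e ] e ∉ W × Σ (Crossing (_∈ X.set) e) P → Crossing (_∈ X.set) f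
              f-crosses-X (e , e∉W , c , _) = subst (Crossing (_∈ X.set)) (crosses-X e∉W c) c

              -- The second edge across `X` must lie in `W`, so its end in `X` belongs to `C`; the
              -- walk from there to `u` then leaves `C` through the wanted `g`.
              beyond : Crossing (_∈ X.set) f → Improvement K
              beyond c with second-crossing (_∈? X.set) c
              ... | e , e≢f , c′@(crossing j p∈X _)
                with walk-crosses (_∈? C) (X.walk p∈X)
                       (W-inside (decidable-stable (e ∈? W) λ e∉W → e≢f (crosses-X e∉W c′)) j) u∉C
              ...   | g , g∉ , d , ps , qs =
                let L = component (_∈? (W ∪ ⁅ g ⁆)) r in g , g∉ ∘ x∈p∪q⁺ ∘ inj₁ , d , L , grows d ps qs g∉ L

        -- An unsafe edge is exchanged by `improve` for one whose removal leaves the root in a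
        -- strictly larger component, which can happen only finitely often.
        find-safe : ∀ {f} → f ∉ W → Crossing (_∈ C) f → ∃[ g ] g ∉ W × Crossing (_∈ C) g × Safe g
        find-safe {f} f∉W c = go f∉W c (component (_∈? _) r) (⊃-wellFounded _)
          where
          go : ∀ {f} → f ∉ W → Crossing (_∈ C) f →
               (K : Component (_∈ W ∪ ⁅ f ⁆) r) → Acc _⊃_ (Component.set K) →
               ∃[ g ] g ∉ W × Crossing (_∈ C) g × Safe g
          go {f} f∉W c K (acc rec) with any? (λ u → ¬? (u ∈? C) ×-dec ¬? (u ∈? Component.set K))
          ... | no none = f , f∉W , c , λ u∉C →
            Component.walk K (decidable-stable (_ ∈? _) λ u∉K → none (_ , u∉C , u∉K))
          ... | yes (u , u∉C , u∉K) with improve f∉W u∉C K u∉K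
          ...   | g , g∉W , d , L , bigger = go g∉W d L (rec bigger)

      -- To be applied with KnownEdge e meaning that γ e is generated, KnownStar v that σ v is.
      record ForcingRules (KnownEdge : Pred (Edge G) 0ℓ) (KnownStar : Pred (Vertex G) 0ℓ) : Set where
        field
          root   : KnownStar r
          spread : ∀ {e u v} → Joins e u v → KnownEdge e → KnownStar u → KnownStar v
          force  : ∀ {e v} → Incident e v → KnownStar v →
                   (∀ {f} → Incident f v → f ≢ e → KnownEdge f) → KnownEdge e

        walk-spread : ∀ {W : Subset (nE G)} {v} → (∀ {e} → e ∉ W → KnownEdge e) → Walk G (_∈ W) v r → KnownStar v
        walk-spread known stay         = root
        walk-spread known (fwd e ok p) = spread against (known ok) (walk-spread known p)
        walk-spread known (bwd e ok p) = spread along (known ok) (walk-spread known p)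

      -- Quantifying over all pairs of predicates keeps the growth of the tree apart from the
      -- algebra; in the end they become membership in the submodule spanned by generators, bonds
      -- and cycles.
      Forced : Subset (nE G) → Set₁
      Forced W = ∀ {KnownEdge KnownStar} → ForcingRules KnownEdge KnownStar →
        (∀ {e} → e ∉ W → KnownEdge e) → ∀ e → KnownEdge e

      -- Growing the spanning tree

      record ForcedTree : Set₁ where
        field
          tree   : Subset (nE G)
          size   : nV G ≡ suc ∣ tree ∣
          forced : Forced tree
          cotree : ∃[ e ] e ∉ tree

      -- `C` and `W` are the vertices and edges of the partial tree. `reachable` is what makes a
      -- next safe edge available; the edge that `cotree` holds at the last stage serves as e₀.
      record Stage (C : Subset (nV G)) (W : Subset (nE G)) : Set₁ where
        field
          root∈     : r ∈ C
          size      : ∣ C ∣ ≡ suc ∣ W ∣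
          inside-C  : ∀ {e u v} → e ∈ W → Joins e u v → u ∈ C
          reachable : ∀ {u} → u ∉ C → Walk G (_∈ W) u r
          forced    : Forced W
          cotree    : ∃[ e ] e ∉ W

      initial : Edge G → Stage ⁅ r ⁆ ⊥
      initial e = record
        { root∈     = x∈⁅x⁆ r
        ; size      = trans (∣⁅x⁆∣≡1 r) (cong suc (sym (∣⊥∣≡0 (nE G))))
        ; inside-C  = λ e∈⊥ _ → contradiction e∈⊥ ∉⊥
        ; reachable = λ {u} _ → avoid-⊥ (proj₁ two-edge-connected u r)
        ; forced    = λ _ known _ → known ∉⊥
        ; cotree    = e , ∉⊥
        }
        where
        avoid-⊥ : ∀ {u v} → Walk G (noEdge G) u v → Walk G (_∈ ⊥) u v
        avoid-⊥ stay        = stay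
        avoid-⊥ (fwd e _ p) = fwd e ∉⊥ (avoid-⊥ p)
        avoid-⊥ (bwd e _ p) = bwd e ∉⊥ (avoid-⊥ p)

      module _ {C W} (stage : Stage C W) where
        open Stage stage

        safe-boundary : ∀ {u} → u ∉ C → ∃[ f ] f ∉ W × Crossing (_∈ C) f × Safe inside-C reachable f
        safe-boundary {u} u∉C with walk-crosses (_∈? C) (proj₁ two-edge-connected r u) root∈ u∉C
        ... | f , _ , c@(crossing j p∈C v∉C) , _ =
          find-safe inside-C reachable (λ f∈W → v∉C (inside-C f∈W (Joins-sym j))) c

        module _ {f p v} (f∉W : f ∉ W) (j : Joins f p v) (p∈C : p ∈ C) (v∉C : v ∉ C)
          (safe : Safe inside-C reachable f) where

          attached-inside : ∀ {e u w} → e ∈ W ∪ ⁅ f ⁆ → Joins e u w → u ∈ C ∪ ⁅ v ⁆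
          attached-inside e∈ i with ∈-insert⁻ e∈
          ... | inj₁ e∈W = x∈p∪q⁺ (inj₁ (inside-C e∈W i))
          ... | inj₂ refl with endpoint j i
          ...   | inj₁ refl = x∈p∪q⁺ (inj₁ p∈C)
          ...   | inj₂ refl = x∈p∪q⁺ (inj₂ (x∈⁅x⁆ v))

          W-avoids-v : ∀ {e} → e ∈ W → ¬ Incident e v
          W-avoids-v e∈W (inj₁ refl) = v∉C (inside-C e∈W along)
          W-avoids-v e∈W (inj₂ refl) = v∉C (inside-C e∈W against)

          -- The star at `v` is known from the walk to `r` that avoids `W` and `f`. No edge of `W`
          -- touches `v`, so `f` is the only edge at `v` left to determine; after that the earlier
          -- stage takes over.
          attached-forced : Forced (W ∪ ⁅ f ⁆)
          attached-forced {KnownEdge} rules known = forced rules known′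
            where
            open ForcingRules rules

            f-known : KnownEdge f
            f-known = force (Joins⇒Incidentʳ j) (walk-spread known (safe v∉C))
              λ at-v g≢f → known (∉-insert (λ g∈W → W-avoids-v g∈W at-v) g≢f)

            known′ : ∀ {e} → e ∉ W → KnownEdge e
            known′ {e} e∉W with e ≟ f
            ... | yes refl = f-known
            ... | no e≢f   = known (∉-insert e∉W e≢f)

          -- The safe walk from `v` to the root has to enter `C`, so it contains an edge.
          attached-cotree : ∃[ e ] e ∉ W ∪ ⁅ f ⁆
          attached-cotree with walk-crosses (¬? ∘ (_∈? C)) (safe v∉C) v∉C (λ r∉C → r∉C root∈)
          ... | e , e∉ , _ = e , e∉

          attach : Stage (C ∪ ⁅ v ⁆) (W ∪ ⁅ f ⁆)
          attach = record
            { root∈     = x∈p∪q⁺ (inj₁ root∈)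
            ; size      = trans (∣p∪⁅x⁆∣ v∉C) (cong suc (trans size (sym (∣p∪⁅x⁆∣ f∉W))))
            ; inside-C  = attached-inside
            ; reachable = λ u∉ → safe (u∉ ∘ x∈p∪q⁺ ∘ inj₁)
            ; forced    = attached-forced
            ; cotree    = attached-cotree
            }

      grow : ∀ {C W} → Stage C W → Acc _⊃_ C → ForcedTree
      grow {C} {W} stage (acc rec) with any? (λ u → ¬? (u ∈? C))
      ... | no none = record { tree = W ; size = trans (sym full) size ; forced = forced ; cotree = cotree }
        where
        open Stage stage

        full : ∣ C ∣ ≡ nV G
        full = trans
          (cong ∣_∣ (⊆-antisym (λ _ → ∈⊤) (λ _ → decidable-stable (_ ∈? C) λ u∉C → none (_ , u∉C))))
          (∣⊤∣≡n (nV G))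
      ... | yes (u , u∉C) with safe-boundary stage u∉C
      ...   | f , f∉W , crossing j p∈C v∉C , safe =
        grow (attach stage f∉W j p∈C v∉C safe) (rec (p∪⁅x⁆⊃p v∉C))

      forced-tree : Edge G → ForcedTree
      forced-tree e = grow (initial e) (⊃-wellFounded _)

-- Finite sums, indicator functions and submodules

sum-cong : ∀ {n} {f g : Fin n → ℤ} → (∀ i → f i ≡ g i) → sumℤ f ≡ sumℤ g
sum-cong {zero}  f≗g = refl
sum-cong {suc n} f≗g = cong₂ _+_ (f≗g zero) (sum-cong (f≗g ∘ suc))

sum-zero : ∀ {n} {f : Fin n → ℤ} → (∀ i → f i ≡ 0ℤ) → sumℤ f ≡ 0ℤ
sum-zero {zero}  f≗0 = refl
sum-zero {suc n} f≗0 = cong₂ _+_ (f≗0 zero) (sum-zero (f≗0 ∘ suc))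

sum-+ : ∀ {n} (f g : Fin n → ℤ) → sumℤ (λ i → f i + g i) ≡ sumℤ f + sumℤ g
sum-+ {zero}  f g = refl
sum-+ {suc n} f g = trans (cong (f zero + g zero +_) (sum-+ (f ∘ suc) (g ∘ suc))) (interchange (f zero) (g zero) _ _)
  where
  interchange : ∀ a b c d → a + b + (c + d) ≡ a + c + (b + d)
  interchange = solve-∀

*-sum : ∀ {n} c (f : Fin n → ℤ) → c * sumℤ f ≡ sumℤ (λ i → c * f i)
*-sum {zero}  c f = *-zeroʳ c
*-sum {suc n} c f = trans (*-distribˡ-+ c (f zero) _) (cong (c * f zero +_) (*-sum c (f ∘ suc)))

sum-* : ∀ {n} (f : Fin n → ℤ) c → sumℤ f * c ≡ sumℤ (λ i → f i * c)
sum-* f c = trans (*-comm (sumℤ f) c) (trans (*-sum c f) (sum-cong λ i → *-comm c (f i)))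

sum-minus : ∀ {n} (f g : Fin n → ℤ) → sumℤ (λ i → f i - g i) ≡ sumℤ f - sumℤ g
sum-minus f g = trans (sum-+ f (λ i → - g i)) (cong (sumℤ f +_) (sum-neg g))
  where
  sum-neg : ∀ {n} (g : Fin n → ℤ) → sumℤ (λ i → - g i) ≡ - sumℤ g
  sum-neg {zero}  g = refl
  sum-neg {suc n} g = trans (cong (- g zero +_) (sum-neg (g ∘ suc))) (sym (neg-distrib-+ (g zero) _))

sum-comm : ∀ {m n} (f : Fin m → Fin n → ℤ) →
  sumℤ (λ i → sumℤ (f i)) ≡ sumℤ (λ j → sumℤ (λ i → f i j))
sum-comm {zero}  f = sym (sum-zero {f = λ j → sumℤ (λ i → f i j)} λ _ → refl)
sum-comm {suc m} f = trans (cong (sumℤ (f zero) +_) (sum-comm (f ∘ suc))) (sym (sum-+ (f zero) _))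

ind-refl : ∀ {n} (a : Fin n) → ind a a ≡ 1ℤ
ind-refl a with a ≟ a
... | yes _  = refl
... | no a≢a = contradiction refl a≢a

ind-≢ : ∀ {n} {a b : Fin n} → a ≢ b → ind a b ≡ 0ℤ
ind-≢ {a = a} {b} a≢b with a ≟ b
... | yes a≡b = contradiction a≡b a≢b
... | no _    = refl

ind-sym : ∀ {n} (a b : Fin n) → ind a b ≡ ind b a
ind-sym a b with a ≟ b
... | yes refl = sym (ind-refl a)
... | no a≢b   = sym (ind-≢ (a≢b ∘ sym))

sum-single : ∀ {n} {f : Fin n → ℤ} a → (∀ i → a ≢ i → f i ≡ 0ℤ) → sumℤ f ≡ f a
sum-single {f = f} zero    off = trans (cong (f zero +_) (sum-zero λ i → off (suc i) λ ())) (+-identityʳ (f zero))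
sum-single {f = f} (suc a) off = trans (cong₂ _+_ (off zero λ ())
  (sum-single a λ i a≢i → off (suc i) (a≢i ∘ suc-injective))) (+-identityˡ (f (suc a)))

sum-ind : ∀ {n} (a : Fin n) (f : Fin n → ℤ) → sumℤ (λ i → ind a i * f i) ≡ f a
sum-ind a f = trans
  (sum-single a λ i a≢i → trans (cong (_* f i) (ind-≢ a≢i)) (*-zeroˡ (f i)))
  (trans (cong (_* f a) (ind-refl a)) (*-identityˡ (f a)))

-- `resp` takes the place of function extensionality, as chains are compared pointwise only.
record IsSubmodule {X : Set} (P : (X → ℤ) → Set) : Set where
  field
    resp     : ∀ {f g} → (∀ x → f x ≡ g x) → P f → P g
    0-closed : P (λ _ → 0ℤ)
    +-closed : ∀ {f g} → P f → P g → P (λ x → f x + g x)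
    *-closed : ∀ c {f} → P f → P (λ x → c * f x)

  minus-closed : ∀ {f g} → P f → P g → P (λ x → f x - g x)
  minus-closed {f} {g} p q = resp (λ x → cong (f x +_) (-1*i≡-i (g x))) (+-closed p (*-closed -1ℤ q))

  sum-closed : ∀ {n} {f : Fin n → X → ℤ} → (∀ i → P (f i)) → P (λ x → sumℤ (λ i → f i x))
  sum-closed {zero}  p = 0-closed
  sum-closed {suc n} p = +-closed (p zero) (sum-closed (p ∘ suc))

-- Incidence numbers, stars and the Laplacian of the line graph

module _ (G : Graph) where
  open Forcing G

  inc : Edge G → Vertex G → ℤ
  inc e v = ind v (src G e) + ind v (tgt G e)

  -- Entry (e, f) of MᵀM for the unsigned incidence matrix M. For simple `G` it is the adjacency
  -- matrix of `line G` off the diagonal, and 2 on the diagonal.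
  common : Edge G → Edge G → ℤ
  common e f = inc f (src G e) + inc f (tgt G e)

  common-sym : ∀ e f → common e f ≡ common f e
  common-sym e f = trans
    (cong₂ _+_ (cong₂ _+_ (ind-sym (src G e) (src G f)) (ind-sym (src G e) (tgt G f)))
               (cong₂ _+_ (ind-sym (tgt G e) (src G f)) (ind-sym (tgt G e) (tgt G f))))
    (transpose (ind (src G f) (src G e)) (ind (tgt G f) (src G e)) (ind (src G f) (tgt G e)) (ind (tgt G f) (tgt G e)))
    where
    transpose : ∀ a b c d → a + b + (c + d) ≡ a + c + (b + d)
    transpose = solve-∀

  module Simple (simple : IsSimple G) where

    no-loop : ∀ e → src G e ≢ tgt G e
    no-loop = proj₁ simple

    inc-incident : ∀ {e v} → Incident e v → inc e v ≡ 1ℤ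
    inc-incident {e} (inj₁ refl) = cong₂ _+_ (ind-refl (src G e)) (ind-≢ (no-loop e))
    inc-incident {e} (inj₂ refl) = cong₂ _+_ (ind-≢ (no-loop e ∘ sym)) (ind-refl (tgt G e))

    inc-elim : ∀ (Q : ℤ → Set) e v → Q 0ℤ → (Incident e v → Q 1ℤ) → Q (inc e v)
    inc-elim Q e v q0 q1 with v ≟ src G e | v ≟ tgt G e
    ... | yes v≡s | yes v≡t = contradiction (trans (sym v≡s) v≡t) (no-loop e)
    ... | yes v≡s | no _    = q1 (inj₁ v≡s)
    ... | no _    | yes v≡t = q1 (inj₂ v≡t)
    ... | no _    | no _    = q0

    -- `shareEnd` is the disjunction of four equalities that `common` counts; two of them at once
    -- would give a loop or a pair of parallel edges.
    share-common : ∀ {e f} → e ≢ f → (if shareEnd G e f then 1ℤ else 0ℤ) ≡ common e f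
    share-common {e} {f} e≢f
      with src G e ≟ src G f | src G e ≟ tgt G f | tgt G e ≟ src G f | tgt G e ≟ tgt G f
    ... | yes a | yes b | _     | _     = contradiction (trans (sym a) b) (no-loop f)
    ... | yes a | no _  | yes c | _     = contradiction (trans a (sym c)) (no-loop e)
    ... | yes a | no _  | no _  | yes d = contradiction (inj₁ (a , d)) (proj₂ simple e f e≢f)
    ... | yes a | no _  | no _  | no _  = refl
    ... | no _  | yes b | yes c | _     = contradiction (inj₂ (b , c)) (proj₂ simple e f e≢f)
    ... | no _  | yes b | no _  | yes d = contradiction (trans b (sym d)) (no-loop e)
    ... | no _  | yes b | no _  | no _  = refl
    ... | no _  | no _  | yes c | yes d = contradiction (trans (sym c) d) (no-loop f)
    ... | no _  | no _  | yes c | no _  = refl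
    ... | no _  | no _  | no _  | yes d = refl
    ... | no _  | no _  | no _  | no _  = refl

    module _ {X : Set} (γ : Edge G → X → ℤ) where

      star : Vertex G → X → ℤ
      star v x = sumℤ (λ e → inc e v * γ e x)

      laplacian : Edge G → X → ℤ
      laplacian e x = sumℤ (λ f → common e f * (γ e x - γ f x))

      -- The factor `sumℤ (common e)` is deg u + deg v, exceeding the degree of `e` in `line G` by
      -- 2; this makes up for γ e occurring once in each of the two stars.
      laplacian-stars : ∀ e x →
        laplacian e x ≡ sumℤ (common e) * γ e x - (star (src G e) x + star (tgt G e) x)
      laplacian-stars e x = begin
        laplacian e x
          ≡⟨ sum-cong (λ f → expand (inc f (src G e)) (inc f (tgt G e)) (γ e x) (γ f x)) ⟩
        sumℤ (λ f → common e f * γ e x - (inc f (src G e) * γ f x + inc f (tgt G e) * γ f x))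
          ≡⟨ sum-minus {nE G} _ _ ⟩
        sumℤ (λ f → common e f * γ e x) - sumℤ (λ f → inc f (src G e) * γ f x + inc f (tgt G e) * γ f x)
          ≡⟨ cong₂ _-_ (sym (sum-* (common e) (γ e x))) (sum-+ {nE G} _ _) ⟩
        sumℤ (common e) * γ e x - (star (src G e) x + star (tgt G e) x) ∎
        where
        open ≡-Reasoning
        expand : ∀ a b c d → (a + b) * (c - d) ≡ (a + b) * c - (a * d + b * d)
        expand = solve-∀

      module _ {P : (X → ℤ) → Set} (P-submodule : IsSubmodule P) (relation : ∀ e → P (laplacian e)) where
        open IsSubmodule P-submodule

        stars∈P : ∀ {e} → P (γ e) → P (λ x → star (src G e) x + star (tgt G e) x)
        stars∈P {e} p = resp
          (λ x → trans (cong (λ y → sumℤ (common e) * γ e x - y) (laplacian-stars e x)) (cancel (sumℤ (common e) * γ e x) _))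
          (minus-closed (*-closed (sumℤ (common e)) p) (relation e))
          where
          cancel : ∀ a b → a - (a - b) ≡ b
          cancel = solve-∀

        spread-star : ∀ {e u v} → Joins e u v → P (γ e) → P (star u) → P (star v)
        spread-star {e} along p q = resp (λ x → cancel (star (src G e) x) _) (minus-closed (stars∈P p) q)
          where
          cancel : ∀ a b → (a + b) - a ≡ b
          cancel = solve-∀
        spread-star {e} against p q = resp (λ x → cancel _ (star (tgt G e) x)) (minus-closed (stars∈P p) q)
          where
          cancel : ∀ a b → (a + b) - b ≡ a
          cancel = solve-∀

        force-edge : ∀ {e v} → Incident e v → P (star v) →
          (∀ {f} → Incident f v → f ≢ e → P (γ f)) → P (γ e)
        force-edge {e} {v} at-v p known = resp isolate (minus-closed p (sum-closed other))
          where
          -- At f = e the coefficient is 1 - 1, because `e` lies at `v` and is no loop; elsewhere it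
          -- is `inc f v`, nonzero only for the other edges at `v`, which are known.
          other : ∀ f → P (λ x → (inc f v - ind e f) * γ f x)
          other f with e ≟ f
          ... | yes refl = resp (λ x → sym (trans (cong (λ c → (c - 1ℤ) * γ e x) (inc-incident at-v)) (*-zeroˡ (γ e x)))) 0-closed
          ... | no e≢f   = inc-elim (λ c → P (λ x → (c - 0ℤ) * γ f x)) f v
            (resp (λ x → sym (*-zeroˡ (γ f x))) 0-closed)
            (λ f-at-v → *-closed 1ℤ (known f-at-v (e≢f ∘ sym)))

          isolate : ∀ x → star v x - sumℤ (λ f → (inc f v - ind e f) * γ f x) ≡ γ e x
          isolate x = begin
            star v x - sumℤ (λ f → (inc f v - ind e f) * γ f x)
              ≡⟨ sym (sum-minus {nE G} _ _) ⟩
            sumℤ (λ f → inc f v * γ f x - (inc f v - ind e f) * γ f x)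
              ≡⟨ sum-cong (λ f → cancel (inc f v) (ind e f) (γ f x)) ⟩
            sumℤ (λ f → ind e f * γ f x)
              ≡⟨ sum-ind e (λ f → γ f x) ⟩
            γ e x ∎
            where
            open ≡-Reasoning
            cancel : ∀ a b c → a * c - (a - b) * c ≡ b * c
            cancel = solve-∀

-- Boundary and coboundary, and the chains generated modulo bonds and cycles

module _ (H : Graph) where
  open ≡-Reasoning

  ∂-0 : ∀ v → ∂ H (λ _ → 0ℤ) v ≡ 0ℤ
  ∂-0 v = sum-zero λ e → *-zeroˡ (ind (tgt H e) v - ind (src H e) v)

  ∂-+ : ∀ (x y : Chain H) v → ∂ H (λ e → x e + y e) v ≡ ∂ H x v + ∂ H y v
  ∂-+ x y v = trans (sum-cong λ e → distrib (x e) (y e) _) (sum-+ {nE H} _ _)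
    where
    distrib : ∀ a b c → (a + b) * c ≡ a * c + b * c
    distrib = solve-∀

  ∂-* : ∀ c (x : Chain H) v → ∂ H (λ e → c * x e) v ≡ c * ∂ H x v
  ∂-* c x v = trans (sum-cong λ e → *-assoc c (x e) _) (sym (*-sum {nE H} c _))

  ∂-minus : ∀ (x y : Chain H) v → ∂ H (λ e → x e - y e) v ≡ ∂ H x v - ∂ H y v
  ∂-minus x y v = trans (sum-cong λ e → distrib (x e) (y e) _) (sum-minus {nE H} _ _)
    where
    distrib : ∀ a b c → (a - b) * c ≡ a * c - b * c
    distrib = solve-∀

  ∂-sum : ∀ {n} (x : Fin n → Chain H) v → ∂ H (λ e → sumℤ (λ i → x i e)) v ≡ sumℤ (λ i → ∂ H (x i) v)
  ∂-sum x v = trans (sum-cong λ e → sum-* (λ i → x i e) _) (sum-comm λ e i → x i e * (ind (tgt H e) v - ind (src H e) v))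

  ∂-ind : ∀ e v → ∂ H (ind e) v ≡ ind (tgt H e) v - ind (src H e) v
  ∂-ind e v = sum-ind e _

  -- Adjointness of ∂ and δ, by exchanging the two sums.
  ∂-pairing : ∀ (x : Chain H) (h : Vertex H → ℤ) → sumℤ (λ v → ∂ H x v * h v) ≡ sumℤ (λ e → x e * δ H h e)
  ∂-pairing x h = begin
    sumℤ (λ v → ∂ H x v * h v)
      ≡⟨ sum-cong (λ v → sum-* {nE H} _ (h v)) ⟩
    sumℤ (λ v → sumℤ (λ e → x e * (ind (tgt H e) v - ind (src H e) v) * h v))
      ≡⟨ sum-comm {nV H} {nE H} _ ⟩
    sumℤ (λ e → sumℤ (λ v → x e * (ind (tgt H e) v - ind (src H e) v) * h v))
      ≡⟨ sum-cong (λ e → sum-cong λ v → distrib (x e) (ind (tgt H e) v) (ind (src H e) v) (h v)) ⟩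
    sumℤ (λ e → sumℤ (λ v → x e * (ind (tgt H e) v * h v - ind (src H e) v * h v)))
      ≡⟨ sum-cong (λ e → sym (*-sum {nV H} (x e) _)) ⟩
    sumℤ (λ e → x e * sumℤ (λ v → ind (tgt H e) v * h v - ind (src H e) v * h v))
      ≡⟨ sum-cong (λ e → cong (x e *_) (trans (sum-minus {nV H} _ _) (cong₂ _-_ (sum-ind (tgt H e) h) (sum-ind (src H e) h)))) ⟩
    sumℤ (λ e → x e * δ H h e) ∎
    where
    distrib : ∀ a b c d → a * (b - c) * d ≡ a * (b * d - c * d)
    distrib = solve-∀

  sum-∂ : ∀ (x : Chain H) → sumℤ (∂ H x) ≡ 0ℤ
  sum-∂ x = begin
    sumℤ (∂ H x)                    ≡⟨ sum-cong (λ v → sym (*-identityʳ (∂ H x v))) ⟩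
    sumℤ (λ v → ∂ H x v * 1ℤ)       ≡⟨ ∂-pairing x (λ _ → 1ℤ) ⟩
    sumℤ (λ e → x e * (1ℤ - 1ℤ))    ≡⟨ sum-zero (λ e → *-zeroʳ (x e)) ⟩
    0ℤ                              ∎

  module _ {k} (g : Fin k → Chain H) where

    -- The condition of `CriticalGroupGeneratedBy` split off for a single chain, so that computing
    -- in K(H) becomes reasoning inside one submodule.
    Generated : Chain H → Set
    Generated x =
      Σ (Fin k → ℤ) λ a → Σ (Chain H) λ b → Σ (Chain H) λ z →
        InBondLattice H b × InCycleLattice H z ×
        ((e : Edge H) → x e ≡ (sumℤ (λ i → a i * g i e) + b e) + z e)

    Generated-isSubmodule : IsSubmodule Generated
    Generated-isSubmodule = record
      { resp     = λ f≗g (a , b , z , bond , cycle , eq) → a , b , z , bond , cycle , λ e → trans (sym (f≗g e)) (eq e)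
      ; 0-closed = (λ _ → 0ℤ) , (λ _ → 0ℤ) , (λ _ → 0ℤ) , ((λ _ → 0ℤ) , λ _ → refl) , ∂-0 ,
          λ e → sym (trans (+-identityʳ _) (trans (+-identityʳ _) (sum-zero {k} λ i → *-zeroˡ (g i e))))
      ; +-closed = λ (a , b , z , (p , b≗δp) , cycle , eq) (a′ , b′ , z′ , (p′ , b′≗δp′) , cycle′ , eq′) →
          (λ i → a i + a′ i) , (λ e → b e + b′ e) , (λ e → z e + z′ e) ,
          ((λ v → p v + p′ v) , λ e →
            trans (cong₂ _+_ (b≗δp e) (b′≗δp′ e)) (shuffle (p (tgt H e)) (p (src H e)) (p′ (tgt H e)) (p′ (src H e)))) ,
          (λ v → trans (∂-+ z z′ v) (cong₂ _+_ (cycle v) (cycle′ v))) ,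
          λ e → trans (cong₂ _+_ (eq e) (eq′ e)) (trans
            (collect (sumℤ λ i → a i * g i e) (b e) (z e) (sumℤ λ i → a′ i * g i e) (b′ e) (z′ e))
            (cong (λ s → s + (b e + b′ e) + (z e + z′ e))
              (sym (trans (sum-cong λ i → distrib (a i) (a′ i) (g i e)) (sum-+ (λ i → a i * g i e) (λ i → a′ i * g i e))))))
      ; *-closed = λ c (a , b , z , (p , b≗δp) , cycle , eq) →
          (λ i → c * a i) , (λ e → c * b e) , (λ e → c * z e) ,
          ((λ v → c * p v) , λ e → trans (cong (c *_) (b≗δp e)) (scale c (p (tgt H e)) (p (src H e)))) ,
          (λ v → trans (∂-* c z v) (trans (cong (c *_) (cycle v)) (*-zeroʳ c))) ,
          λ e → trans (cong (c *_) (eq e)) (trans (scale₃ c _ (b e) (z e))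
            (cong (λ s → s + c * b e + c * z e)
              (trans (*-sum {k} c _) (sum-cong λ i → sym (*-assoc c (a i) (g i e))))))
      }
      where
      shuffle : ∀ a b c d → (a - b) + (c - d) ≡ (a + c) - (b + d)
      shuffle = solve-∀
      collect : ∀ a b c d e f → (a + b + c) + (d + e + f) ≡ a + d + (b + e) + (c + f)
      collect = solve-∀
      distrib : ∀ a b c → (a + b) * c ≡ a * c + b * c
      distrib = solve-∀
      scale : ∀ c a b → c * (a - b) ≡ c * a - c * b
      scale = solve-∀
      scale₃ : ∀ c x y z → c * (x + y + z) ≡ c * x + c * y + c * z
      scale₃ = solve-∀

    generator : ∀ i → Generated (g i)
    generator i = ind i , (λ _ → 0ℤ) , (λ _ → 0ℤ) , ((λ _ → 0ℤ) , λ _ → refl) , ∂-0 ,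
      λ e → sym (trans (+-identityʳ _) (trans (+-identityʳ _) (sum-ind i λ j → g j e)))

    bond-generated : ∀ p → Generated (δ H p)
    bond-generated p = (λ _ → 0ℤ) , δ H p , (λ _ → 0ℤ) , (p , λ _ → refl) , ∂-0 ,
      λ e → sym (trans (+-identityʳ _) (trans (cong (_+ δ H p e) (sum-zero {k} λ i → *-zeroˡ (g i e))) (+-identityˡ _)))

    cycle-generated : ∀ {z} → InCycleLattice H z → Generated z
    cycle-generated {z} cycle = (λ _ → 0ℤ) , (λ _ → 0ℤ) , z , ((λ _ → 0ℤ) , λ _ → refl) , cycle ,
      λ e → sym (trans (cong (_+ z e) (trans (+-identityʳ _) (sum-zero {k} λ i → *-zeroˡ (g i e)))) (+-identityˡ (z e)))

  module Based {v₀ : Vertex H} (γ : Vertex H → Chain H)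
    (∂γ : ∀ v w → ∂ H (γ v) w ≡ ind v w - ind v₀ w) where

    -- Represents the class of `x` by the classes of the `γ v`: it has the same boundary as `x` and
    -- so differs from it by a cycle.
    along-γ : Chain H → Chain H
    along-γ x e = sumℤ (λ v → ∂ H x v * γ v e)

    -- The base vertex v₀ receives minus the total of ∂ x, which is zero by `sum-∂`.
    ∂-along-γ : ∀ x w → ∂ H (along-γ x) w ≡ ∂ H x w
    ∂-along-γ x w = begin
      ∂ H (along-γ x) w
        ≡⟨ ∂-sum (λ v e → ∂ H x v * γ v e) w ⟩
      sumℤ (λ v → ∂ H (λ e → ∂ H x v * γ v e) w)
        ≡⟨ sum-cong (λ v → trans (∂-* (∂ H x v) (γ v) w) (cong (∂ H x v *_) (∂γ v w))) ⟩
      sumℤ (λ v → ∂ H x v * (ind v w - ind v₀ w))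
        ≡⟨ sum-cong (λ v → trans (cong (λ i → ∂ H x v * (i - ind v₀ w)) (ind-sym v w)) (expand (∂ H x v) (ind w v) _)) ⟩
      sumℤ (λ v → ind w v * ∂ H x v - ∂ H x v * ind v₀ w)
        ≡⟨ sum-minus {nV H} _ _ ⟩
      sumℤ (λ v → ind w v * ∂ H x v) - sumℤ (λ v → ∂ H x v * ind v₀ w)
        ≡⟨ cong₂ _-_ (sum-ind w (∂ H x)) (trans (sym (sum-* (∂ H x) (ind v₀ w))) (cong (_* ind v₀ w) (sum-∂ x))) ⟩
      ∂ H x w - 0ℤ * ind v₀ w
        ≡⟨ drop (∂ H x w) (ind v₀ w) ⟩
      ∂ H x w ∎
      where
      expand : ∀ a b c → a * (b - c) ≡ b * a - a * c
      expand = solve-∀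
      drop : ∀ a b → a - 0ℤ * b ≡ a
      drop = solve-∀

    minus-along-γ-cycle : ∀ x → InCycleLattice H (λ e → x e - along-γ x e)
    minus-along-γ-cycle x w = trans (∂-minus x (along-γ x) w)
      (trans (cong (λ y → ∂ H x w - y) (∂-along-γ x w)) (+-inverseʳ (∂ H x w)))

    module _ {k} (g : Fin k → Chain H) where
      open IsSubmodule (Generated-isSubmodule g)

      along-γ⇒ : ∀ {x} → Generated g (along-γ x) → Generated g x
      along-γ⇒ {x} p = resp (λ e → cancel (along-γ x e) (x e)) (+-closed p (cycle-generated g (minus-along-γ-cycle x)))
        where
        cancel : ∀ a b → a + (b - a) ≡ b
        cancel = solve-∀

      ⇒along-γ : ∀ {x} → Generated g x → Generated g (along-γ x)
      ⇒along-γ {x} p = resp (λ e → cancel (x e) (along-γ x e)) (minus-closed p (cycle-generated g (minus-along-γ-cycle x)))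
        where
        cancel : ∀ a b → a - (a - b) ≡ b
        cancel = solve-∀

      base-generated : Generated g (γ v₀)
      base-generated = cycle-generated g λ w → trans (∂γ v₀ w) (+-inverseʳ (ind v₀ w))

      generated-by-γ : (∀ v → Generated g (γ v)) → ∀ x → Generated g x
      generated-by-γ all x = along-γ⇒ (sum-closed λ v → *-closed (∂ H x v) (all v))

-- Sums over lists

sumOver : ∀ {A : Set} → (A → ℤ) → List A → ℤ
sumOver F xs = sumℤ (F ∘ lookup xs)

sumOver-++ : ∀ {A : Set} (F : A → ℤ) xs ys → sumOver F (xs ++ ys) ≡ sumOver F xs + sumOver F ys
sumOver-++ F []       ys = sym (+-identityˡ _)
sumOver-++ F (x ∷ xs) ys = trans (cong (F x +_) (sumOver-++ F xs ys)) (sym (+-assoc (F x) _ _))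

sumOver-concatMap : ∀ {A B : Set} {n} (F : B → ℤ) (h : A → List B) (t : Fin n → A) →
  sumOver F (concatMap h (tabulate t)) ≡ sumℤ (λ i → sumOver F (h (t i)))
sumOver-concatMap {n = zero}  F h t = refl
sumOver-concatMap {n = suc n} F h t = trans (sumOver-++ F (h (t zero)) _)
  (cong (sumOver F (h (t zero)) +_) (sumOver-concatMap F h (t ∘ suc)))

[_]? : Bool → ℤ
[ b ]? = if b then 1ℤ else 0ℤ

sumOver-if : ∀ {A : Set} (F : A → ℤ) b x → sumOver F (if b then x ∷ [] else []) ≡ [ b ]? * F x
sumOver-if F true  x = trans (+-identityʳ (F x)) (sym (*-identityˡ (F x)))
sumOver-if F false x = refl

-- Adjacency, connectedness and Laplacian of the line graph

module _ (G : Graph) where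
  open Forcing G

  precedes : Edge G → Edge G → Bool
  precedes i j = (toℕ i <ᵇ toℕ j) ∧ shareEnd G i j

  -- The left side is by definition a `sumOver` the list `lineEdges G`, so each `concatMap` turns
  -- into a sum.
  sum-line : ∀ (F : Edge G → Edge G → ℤ) →
    sumℤ (λ ℓ → F (src (line G) ℓ) (tgt (line G) ℓ)) ≡ sumℤ (λ i → sumℤ (λ j → [ precedes i j ]? * F i j))
  sum-line F = trans
    (sumOver-concatMap F′ row id)
    (sum-cong λ i → trans (sumOver-concatMap F′ (cell i) id) (sum-cong λ j → sumOver-if F′ (precedes i j) (i , j)))
    where
    F′ : Edge G × Edge G → ℤ
    F′ (i , j) = F i j
    cell : Edge G → Edge G → List (Edge G × Edge G)
    cell i j = if precedes i j then (i , j) ∷ [] else []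
    row : Edge G → List (Edge G × Edge G)
    row i = concatMap (cell i) (allFin (nE G))

  line-edge : ∀ {e f} → precedes e f ≡ true → ∃[ ℓ ] src (line G) ℓ ≡ e × tgt (line G) ℓ ≡ f
  line-edge {e} {f} e→f = index e,f∈ , cong proj₁ (sym (lookup-index e,f∈)) , cong proj₂ (sym (lookup-index e,f∈))
    where
    e,f∈ : (e , f) ∈ᴸ lineEdges G
    e,f∈ = ∈-concatMap⁺ _ (lose (∈-allFin e) (∈-concatMap⁺ _ (lose (∈-allFin f)
      (subst (λ b → (e , f) ∈ᴸ (if b then (e , f) ∷ [] else [])) (sym e→f) (Any.here refl)))))

  <⇒<ᵇ≡true : ∀ {m n} → m < n → (m <ᵇ n) ≡ true
  <⇒<ᵇ≡true m<n = Equivalence.to T-≡ (ℕ.<⇒<ᵇ m<n)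

  ≮⇒<ᵇ≡false : ∀ {m n} → ¬ m < n → (m <ᵇ n) ≡ false
  ≮⇒<ᵇ≡false {m} {n} m≮n = ¬-not λ eq → m≮n (ℕ.<ᵇ⇒< m n (Equivalence.from T-≡ eq))

  incident⇒share : ∀ {e f v} → Incident e v → Incident f v → shareEnd G e f ≡ true
  incident⇒share {e} {f} p q
    with src G e ≟ src G f | src G e ≟ tgt G f | tgt G e ≟ src G f | tgt G e ≟ tgt G f
  ... | yes _ | _     | _     | _     = refl
  ... | no _  | yes _ | _     | _     = refl
  ... | no _  | no _  | yes _ | _     = refl
  ... | no _  | no _  | no _  | yes _ = refl
  ... | no ss | no st | no ts | no tt′ = contradiction (p , q) apart
    where
    apart : ¬ (Incident e _ × Incident f _)
    apart (inj₁ refl , inj₁ eq) = ss eq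
    apart (inj₁ refl , inj₂ eq) = st eq
    apart (inj₂ refl , inj₁ eq) = ts eq
    apart (inj₂ refl , inj₂ eq) = tt′ eq

  line-adjacent : ∀ {e f v} → Incident e v → Incident f v → e ≢ f → ∃[ ℓ ] Forcing.Joins (line G) ℓ e f
  -- A pair is listed once, directed from the smaller index to the larger, so comparing the indices
  -- decides the direction.
  line-adjacent {e} {f} p q e≢f with ℕ.<-cmp (toℕ e) (toℕ f)
  ... | tri< e<f _ _ with line-edge (cong₂ _∧_ (<⇒<ᵇ≡true e<f) (incident⇒share p q))
  ...   | ℓ , refl , refl = ℓ , Forcing.along
  line-adjacent p q e≢f | tri≈ _ e≡f _ = contradiction (toℕ-injective e≡f) e≢f
  line-adjacent p q e≢f | tri> _ _ f<e with line-edge (cong₂ _∧_ (<⇒<ᵇ≡true f<e) (incident⇒share q p))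
  ...   | ℓ , refl , refl = ℓ , Forcing.against

  module _ (connected : Connected G) (e₀ : Edge G) where

    Linked : Edge G → Set
    Linked f = Σ[ c ∈ Chain (line G) ] (∀ w → ∂ (line G) c w ≡ ind f w - ind e₀ w)

    linked-base : Linked e₀
    linked-base = (λ _ → 0ℤ) , λ w → trans (∂-0 (line G) w) (sym (+-inverseʳ (ind e₀ w)))

    linked-step : ∀ {ℓ e f} → Forcing.Joins (line G) ℓ e f → Linked e → Linked f
    linked-step {ℓ} {e} {f} Forcing.along (c , ∂c) = (λ i → c i + ind ℓ i) , λ w →
      trans (∂-+ (line G) c (ind ℓ) w) (trans (cong₂ _+_ (∂c w) (∂-ind (line G) ℓ w)) (telescope (ind e w) (ind e₀ w) (ind f w)))
      where
      telescope : ∀ a b c → (a - b) + (c - a) ≡ c - b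
      telescope = solve-∀
    linked-step {ℓ} {e} {f} Forcing.against (c , ∂c) = (λ i → c i - ind ℓ i) , λ w →
      trans (∂-minus (line G) c (ind ℓ) w) (trans (cong₂ _-_ (∂c w) (∂-ind (line G) ℓ w)) (telescope (ind e w) (ind e₀ w) (ind f w)))
      where
      telescope : ∀ a b c → (a - b) - (a - c) ≡ c - b
      telescope = solve-∀

    linked-adjacent : ∀ {e f v} → Incident e v → Incident f v → Linked e → Linked f
    linked-adjacent {e} {f} p q linked with e ≟ f
    ... | yes refl = linked
    ... | no e≢f   = linked-step (proj₂ (line-adjacent p q e≢f)) linked

    -- Consecutive edges of a walk in `G` share a vertex, hence are equal or adjacent in `line G`;
    -- this is how connectedness passes to the line graph.
    linked-walk : ∀ {avoid u v e f} → Walk G avoid u v → Incident e u → Incident f v → Linked e → Linked f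
    linked-walk stay        p q linked = linked-adjacent p q linked
    linked-walk (fwd g _ w) p q linked = linked-walk {e = g} w (inj₂ refl) q (linked-adjacent p (inj₁ refl) linked)
    linked-walk (bwd g _ w) p q linked = linked-walk {e = g} w (inj₁ refl) q (linked-adjacent p (inj₂ refl) linked)

    linked : ∀ f → Linked f
    linked f = linked-walk (connected (src G e₀) (src G f)) (inj₁ refl) (inj₁ refl) linked-base

  module _ (simple : IsSimple G) where
    open Simple G simple

    precedes-common : ∀ {e f} → e ≢ f → [ precedes f e ]? + [ precedes e f ]? ≡ common G e f
    precedes-common {e} {f} e≢f with ℕ.<-cmp (toℕ e) (toℕ f)
    ... | tri< e<f _ f≮e = trans
      (cong₂ (λ b c → [ b ∧ shareEnd G f e ]? + [ c ∧ shareEnd G e f ]?) (≮⇒<ᵇ≡false f≮e) (<⇒<ᵇ≡true e<f))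
      (trans (+-identityˡ _) (share-common e≢f))
    ... | tri≈ _ e≡f _   = contradiction (toℕ-injective e≡f) e≢f
    ... | tri> e≮f _ f<e = trans
      (cong₂ (λ b c → [ b ∧ shareEnd G f e ]? + [ c ∧ shareEnd G e f ]?) (<⇒<ᵇ≡true f<e) (≮⇒<ᵇ≡false e≮f))
      (trans (+-identityʳ _) (trans (share-common (e≢f ∘ sym)) (common-sym G f e)))

    -- Each line edge at `e` contributes h e - h f, with `f` its other end, whichever way it is
    -- directed.
    line-laplacian : ∀ e (h : Edge G → ℤ) →
      sumℤ (λ ℓ → δ (line G) (ind e) ℓ * δ (line G) h ℓ) ≡ sumℤ (λ f → common G e f * (h e - h f))
    line-laplacian e h = begin
      sumℤ (λ ℓ → δ (line G) (ind e) ℓ * δ (line G) h ℓ)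
        ≡⟨ sum-line (λ i j → (ind e j - ind e i) * (h j - h i)) ⟩
      sumℤ (λ i → sumℤ (λ j → [ precedes i j ]? * ((ind e j - ind e i) * (h j - h i))))
        ≡⟨ sum-cong (λ i → trans
             (sum-cong λ j → expand [ precedes i j ]? (ind e i) (ind e j) (h i) (h j))
             (sum-+ {nE G} _ _)) ⟩
      sumℤ (λ i → sumℤ (λ j → ind e j * ([ precedes i j ]? * (h j - h i)))
                + sumℤ (λ j → ind e i * ([ precedes i j ]? * (h i - h j))))
        ≡⟨ sum-+ {nE G} _ _ ⟩
      sumℤ (λ i → sumℤ (λ j → ind e j * ([ precedes i j ]? * (h j - h i)))) +
      sumℤ (λ i → sumℤ (λ j → ind e i * ([ precedes i j ]? * (h i - h j))))
        ≡⟨ cong₂ _+_ (sum-cong λ i → sum-ind e (λ j → [ precedes i j ]? * (h j - h i)))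
                     (trans (sum-comm {nE G} {nE G} _)
                       (sum-cong λ j → sum-ind e (λ i → [ precedes i j ]? * (h i - h j)))) ⟩
      sumℤ (λ f → [ precedes f e ]? * (h e - h f)) + sumℤ (λ f → [ precedes e f ]? * (h e - h f))
        ≡⟨ sym (sum-+ {nE G} _ _) ⟩
      sumℤ (λ f → [ precedes f e ]? * (h e - h f) + [ precedes e f ]? * (h e - h f))
        ≡⟨ sum-cong pointwise ⟩
      sumℤ (λ f → common G e f * (h e - h f)) ∎
      where
      open ≡-Reasoning
      expand : ∀ p a b c d → p * ((b - a) * (d - c)) ≡ b * (p * (d - c)) + a * (p * (c - d))
      expand = solve-∀
      factor : ∀ a b c → a * c + b * c ≡ (a + b) * c
      factor = solve-∀
      vanish : ∀ a b c d → a * (d - d) + b * (d - d) ≡ c * (d - d)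
      vanish = solve-∀
      pointwise : ∀ f → [ precedes f e ]? * (h e - h f) + [ precedes e f ]? * (h e - h f) ≡ common G e f * (h e - h f)
      pointwise f with e ≟ f
      -- On the diagonal the coefficients differ, 0 against 2, but both multiply h e - h e.
      ... | yes refl = vanish [ precedes e e ]? [ precedes e e ]? (common G e e) (h e)
      ... | no e≢f   = trans (factor [ precedes f e ]? [ precedes e f ]? (h e - h f)) (cong (_* (h e - h f)) (precedes-common e≢f))

-- Counting the edges outside the tree

enumerate : ∀ {n} (p : Subset n) → Σ[ h ∈ (Fin ∣ p ∣ → Fin n) ] (∀ {x} → x ∈ p → ∃[ i ] h i ≡ x)
enumerate []ⱽ = (λ ()) , λ ()
enumerate (inside ∷ⱽ p) with enumerate p
... | h , onto = (λ { zero → zero ; (suc i) → suc (h i) }) , λ where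
  here       → zero , refl
  (there x∈) → let i , eq = onto x∈ in suc i , cong suc eq
enumerate (outside ∷ⱽ p) with enumerate p
... | h , onto = suc ∘ h , λ where (there x∈) → let i , eq = onto x∈ in i , cong suc eq

beta≡∣cotree∣ : ∀ G {W : Subset (nE G)} → nV G ≡ suc ∣ W ∣ → beta G ≡ ∣ ∁ W ∣
-- By `size` there is a vertex, so one component is counted; it cancels against the one vertex by
-- which V outnumbers the tree edges.
beta≡∣cotree∣ record { nV = suc _ ; edges = es } {W} size =
  trans (cong₂ _∸_ (ℕ.+-comm _ 1) size) (sym (∣∁p∣≡n∸∣p∣ W))

-- The generators of the critical group of the line graph

module _ (G : Graph) (simple : IsSimple G) (two-edge-connected : TwoEdgeConnected G) (e₀ : Edge G) (r : Vertex G)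
  {W : Subset (nE G)} (forced : Forcing.Forced G two-edge-connected r W) (e₀∉W : e₀ ∉ W) where
  open Forcing G
  open Simple G simple

  γ : Edge G → Chain (line G)
  γ = proj₁ ∘ linked G (proj₁ two-edge-connected) e₀

  open Based (line G) γ (proj₂ ∘ linked G (proj₁ two-edge-connected) e₀)

  cotree : Fin ∣ ∁ W ∣ → Edge G
  cotree = proj₁ (enumerate (∁ W))

  -- The class of γ e₀ is trivial, so its slot is free for the star at the root.
  gens : Fin ∣ ∁ W ∣ → Chain (line G)
  gens i with cotree i ≟ e₀
  ... | yes _ = star γ r
  ... | no _  = γ (cotree i)

  P : Chain (line G) → Set
  P = Generated (line G) gens

  open IsSubmodule (Generated-isSubmodule (line G) gens)

  -- Modulo cycles the bond at the vertex `e` of `line G` equals its `along-γ`; adjointness turns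
  -- that combination of the γ f into the Laplacian row of `e`.
  relation : ∀ e → P (laplacian γ e)
  relation e = resp
    (λ ℓ → trans (∂-pairing (line G) (δ (line G) (ind e)) (λ f → γ f ℓ)) (line-laplacian G simple e (λ f → γ f ℓ)))
    (⇒along-γ gens (bond-generated (line G) gens (ind e)))

  gens-base : ∀ {i} → cotree i ≡ e₀ → P (star γ r)
  gens-base {i} eq with cotree i ≟ e₀ | generator (line G) gens i
  ... | yes _ | p = p
  ... | no ¬eq | _ = contradiction eq ¬eq

  -- An edge other than e₀ finds γ in its own slot, while γ e₀ is a cycle and can give up its slot.
  cotree-generated : ∀ {e} → e ∉ W → P (γ e)
  cotree-generated {e} e∉W with e ≟ e₀ | proj₂ (enumerate (∁ W)) (x∉p⇒x∈∁p e∉W)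
  ... | yes refl | _ = base-generated gens
  ... | no e≢e₀ | i , refl with cotree i ≟ e₀ | generator (line G) gens i
  ...   | yes eq | _ = contradiction eq e≢e₀
  ...   | no _   | p = p

  generates : CriticalGroupGeneratedBy (line G) ∣ ∁ W ∣
  generates = gens , generated-by-γ gens (forced
    {KnownStar = λ v → P (star γ v)}
    (record
      { root   = gens-base (proj₂ (proj₂ (enumerate (∁ W)) (x∉p⇒x∈∁p e₀∉W)))
      ; spread = spread-star γ (Generated-isSubmodule (line G) gens) relation
      ; force  = force-edge γ (Generated-isSubmodule (line G) gens) relation
      })
    cotree-generated)

theorem1p1 : (G : Graph) → IsSimple G → TwoEdgeConnected G →
    CriticalGroupGeneratedBy (line G) (beta G)
theorem1p1 G simple two-edge-connected with any? {n = nE G} (λ _ → yes tt)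
-- Without edges in `G` the line graph has neither vertices nor edges, so every condition is
-- vacuous, whatever the number of generators.
... | no none = (λ _ _ → 0ℤ) , λ x →
  (λ _ → 0ℤ) , x , x , ((λ _ → 0ℤ) , λ ℓ → contradiction (src (line G) ℓ , tt) none) ,
  (λ e → contradiction (e , tt) none) , λ ℓ → contradiction (src (line G) ℓ , tt) none
-- The edge found supplies the root and the initial edge outside the tree; e₀ is an edge still
-- outside when the tree is complete.
... | yes (e , _) with Forcing.forced-tree G two-edge-connected (src G e) e
...   | record { tree = W ; size = size ; forced = forced ; cotree = e₀ , e₀∉W } =
  subst (CriticalGroupGeneratedBy (line G)) (sym (beta≡∣cotree∣ G {W} size))
    (generates G simple two-edge-connected e₀ (src G e) forced e₀∉W)
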